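{- Let $\langle\mathcal{D},\mathcal{S},\mathcal{R}\rangle$ be a DT problem. Then (a) there is a type assignment such that for all $\ell\to r\in\mathcal{D}\cup\mathcal{R}$, $\ell$ and $r$ get the same type, and such that for all well-typed $t\in\mathcal{T}^{\mathcal{D}\cup\mathcal{R}}_{\mathrm{basic}}$, $$\mathit{Cplx}_{\langle\mathcal{D},\mathcal{S},\mathcal{R}\rangle}(t^\sharp)\;\geq\;\mathrm{dh}\bigl(t,\xrightarrow{\mathsf{i}}_{\mathcal{S}/((\mathcal{D}\setminus\mathcal{S})\cup\mathcal{R})}\bigr);$$ (b) for all $n\in\mathbb{N}$, $\ \mathrm{irc}_{\langle\mathcal{D},\mathcal{S},\mathcal{R}\rangle}(n)\;\geq\;\mathrm{irc}_{\mathcal{S}/((\mathcal{D}\setminus\mathcal{S})\cup\mathcal{R})}(n)$.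
   Context: Terms and rewriting. $\mathcal{T}(\Sigma,\mathcal{V})$ is the set of first-order terms over a finite signature $\Sigma$ and variables $\mathcal{V}$. The size of a term is $|x|=1$ for $x\in\mathcal{V}$ and $|f(t_1,\ldots,t_n)|=1+\sum_i|t_i|$. $t|_\pi$ is the subterm of $t$ at position $\pi$, $t[s]_\pi$ is $t$ with that subterm replaced by $s$. A term rewrite system (TRS) $\mathcal{R}$ is a finite set of rules $\ell \to r$ with $\ell,r$ terms, $\ell \notin \mathcal{V}$ and $\mathcal{V}(r) \subseteq \mathcal{V}(\ell)$ (where $\mathcal{V}(t)$ is the set of variables of $t$). $s \to_{\mathcal{R}} t$ iff $s|_\pi = \ell\sigma$ and $t = s[r\sigma]_\pi$ for some $\ell\to r\in\mathcal{R}$, position $\pi$ of $s$ and substitution $\sigma$; $\ell\sigma$ is the redex. It is an innermost redex if no proper subterm of it is a redex, and then the step is an innermost step, written $s \xrightarrow{\mathsf{i}}_{\mathcal{R}} t$. For a TRS $\mathcal{R}$ over $\Sigma$, the defined symbols are $\Sigma_d^{\mathcal{R}}=\{f \mid f(\ell_1,\ldots,\ell_n)\to r\in\mathcal{R}\}$ and the constructor symbols are $\Sigma_c^{\mathcal{R}}=\Sigma\setminus\Sigma_d^{\mathcal{R}}$. $\mathcal{T}^{\mathcal{R}}_{\mathrm{basic}}$ is the set of basic terms, i.e., terms $f(t_1,\ldots,t_k)$ with $f \in\Sigma_d^{\mathcal{R}}$ and all $t_i\in\mathcal{T}(\Sigma_c^{\mathcal{R}},\mathcal{V})$. Type assignments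 are many-sorted, first-order and monomorphic: each $n$-ary function symbol of the considered signature gets a type $\alpha_1\times\cdots\times\alpha_n\to\alpha$ where the $\alpha_i,\alpha$ are sorts; a term is well typed if, for some assignment of sorts to its variables, all arguments of function symbols have the expected sorts, and its type is its resulting sort (for a rule, the same assignment of sorts to variables is used for both sides). Derivation height: $\mathrm{dh}(t,\to)=\sup\{e \mid \exists t'.\ t\to^e t'\}\in\mathbb{N}\cup\{\omega\}$, with value $\omega$ if $t$ starts an infinite $\to$-sequence; $\sup$ is the least upper bound in $\mathbb{N}\cup\{\omega\}$, $\sup\emptyset=0$. Relative rewriting: for TRSs $\mathcal{R}_1,\mathcal{R}_2$, $\mathcal{R}_1/\mathcal{R}_2$ is a relative TRS, and $s\xrightarrow{\mathsf{i}}_{\mathcal{R}_1/\mathcal{R}_2}t$ iff $s\to^*_{\mathcal{R}_2}s'\to_{\mathcal{R}_1}s''\to^*_{\mathcal{R}_2}t$ for some $s',s''$ such that the proper subterms of the redexes of each of these $\to_{\mathcal{R}_1}$- and $\to_{\mathcal{R}_2}$-steps are in normal form w.r.t. $\mathcal{R}_1\cup\mathcal{R}_2$. Its basic terms are $\mathcal{T}^{\mathcal{R}_1/\mathcal{R}_2}_{\mathrm{basic}}=\mathcal{T}^{\mathcal{R}_1\cup\mathcal{R}_2}_{\mathrm{basic}}$, and $\mathrm{irc}_{\mathcal{R}_1/\mathcal{R}_2}(n)=\sup\{\mathrm{dh}(t,\xrightarrow{\mathsf{i}}_{\mathcal{R}_1/\mathcal{R}_2})\mid t\in\mathcal{T}^{\mathcal{R}_1/\mathcal{R}_2}_{\mathrm{basic}},\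 |t|\le n\}$. Sharp terms: for every $f\in\Sigma_d=\Sigma_d^{\mathcal{R}}$ introduce a fresh symbol $f^\sharp$ of the same arity. For $t=f(t_1,\ldots,t_n)$ with $f\in\Sigma_d$, $t^\sharp=f^\sharp(t_1,\ldots,t_n)$; for all other terms $t^\sharp=t$ (in particular, $t^\sharp=t$ if the root of $t$ is already a sharp symbol). $\mathcal{T}^\sharp=\{t^\sharp\mid t\in\mathcal{T}(\Sigma,\mathcal{V}),\ \mathrm{root}(t)\in\Sigma_d\}$. For each $n$ let $\mathsf{Com}_n$ be a fresh "compound" symbol of arity $n$. A dependency tuple (DT) is a rule $s^\sharp\to\mathsf{Com}_n(t_1^\sharp,\ldots,t_n^\sharp)$ with $s^\sharp,t_1^\sharp,\ldots,t_n^\sharp\in\mathcal{T}^\sharp$. A DT problem is a triple $\langle\mathcal{D},\mathcal{S},\mathcal{R}\rangle$ with $\mathcal{R}$ a TRS over $\Sigma$, $\mathcal{D}$ a finite set of DTs and $\mathcal{S}\subseteq\mathcal{D}$. The relative TRS corresponding to it is $\mathcal{S}/((\mathcal{D}\setminus\mathcal{S})\cup\mathcal{R})$, over the signature $\Sigma$ extended by the sharp symbols and the compound symbols. Chain trees: let $T$ be a (possibly infinite) tree whose nodes are labelled with pairs $(q^\sharp\to\mathsf{Com}_n(w_1^\sharp,\ldots,w_n^\sharp)\mid\nu)$ of a DT from $\mathcal{D}$ and a substitution $\nu$, with root label $(s^\sharp\to\mathsf{Com}_e(\ldots)\mid\sigma)$. $T$ is a $(\mathcal{D},\mathcal{R})$-chain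 tree for $s^\sharp\sigma$ iff for every node, with label $(u^\sharp\to\mathsf{Com}_m(v_1^\sharp,\ldots,v_m^\sharp)\mid\mu)$: (i) $u^\sharp\mu$ is in normal form w.r.t. $\mathcal{R}$; (ii) if its children are labelled $(p_1^\sharp\to\mathsf{Com}_{m_1}(\ldots)\mid\delta_1),\ldots,(p_k^\sharp\to\mathsf{Com}_{m_k}(\ldots)\mid\delta_k)$, then there are pairwise different $i_1,\ldots,i_k\in\{1,\ldots,m\}$ with $v_{i_j}^\sharp\mu\xrightarrow{\mathsf{i}}{}^{*}_{\mathcal{R}}p_j^\sharp\delta_j$ for all $j\in\{1,\ldots,k\}$. Complexity of DT problems: $|T|_{\mathcal{S}}\in\mathbb{N}\cup\{\omega\}$ is the number of nodes of $T$ labelled with a DT from $\mathcal{S}$, and $\mathit{Cplx}_{\langle\mathcal{D},\mathcal{S},\mathcal{R}\rangle}(s^\sharp)=\sup\{|T|_{\mathcal{S}}\mid T\text{ is a }(\mathcal{D},\mathcal{R})\text{ -chain tree for }s^\sharp\}$; it is $0$ for terms $s^\sharp$ that have no chain tree. $\mathrm{irc}_{\langle\mathcal{D},\mathcal{S},\mathcal{R}\rangle}(n)=\sup\{\mathit{Cplx}_{\langle\mathcal{D},\mathcal{S},\mathcal{R}\rangle}(t^\sharp)\mid t\in\mathcal{T}^{\mathcal{R}}_{\mathrm{basic}},\ |t|\le n\}$. -}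

module Defs where

open import Data.Fin.Base using (Fin)
import Data.Fin.Properties as Fin
open import Data.List.Base as List using (List; length)
open import Data.List.Membership.Propositional using (_∈_; find; lose)
open import Data.List.Relation.Binary.Subset.Propositional using (_⊆_)
open import Data.List.Relation.Unary.All using (All)
open import Data.List.Relation.Unary.Any using (any?)
open import Data.List.Relation.Unary.Unique.Propositional using (Unique)
open import Data.Maybe.Base using (Maybe; just; nothing)
open import Data.Maybe.Properties using (≡-dec)
open import Data.Nat.Base using (ℕ; suc; _+_; _≤_; z≤n)
open import Data.Nat.Properties using (≤-trans)
open import Data.Product.Base using (Σ-syntax; ∃; ∃-syntax; _×_; _,_; proj₁; proj₂)
open import Data.Sum.Base using (_⊎_; inj₁; inj₂)
open import Data.Vec.Base as Vec using (Vec; []; _∷_; lookup; _[_]≔_)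
open import Function.Base using (_∘_)
open import Function.Definitions using (Injective)
open import Level using (0ℓ)
open import Relation.Binary.Construct.Closure.ReflexiveTransitive using (Star)
open import Relation.Binary.Core using (Rel)
open import Relation.Binary.PropositionalEquality using (_≡_; _≢_; refl)
open import Relation.Nullary using (¬_; Dec; yes; no)
open import Relation.Nullary.Decidable using (map′)
open import Relation.Unary using (Pred; _∪_; _∖_)

-- An element x of ℕ ∪ {ω} is given by the set { k ∈ ℕ | k ≤ x }: the number n
-- is { 0 , … , n } and ω is all of ℕ.  Every family then has a least upper
-- bound without any appeal to classical logic.
record ℕ∞ : Set₁ where
  field
    _≼     : ℕ → Set
    0≼     : 0 ≼
    ≼-down : ∀ {j k} → j ≤ k → k ≼ → j ≼

open ℕ∞ using (_≼) public

fin : ℕ → ℕ∞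
fin n = record { _≼ = _≤ n ; 0≼ = z≤n ; ≼-down = ≤-trans }

infix 4 _≥∞_
_≥∞_ : ℕ∞ → ℕ∞ → Set
x ≥∞ y = ∀ k → (y ≼) k → (x ≼) k

-- The first alternative only matters for sup ∅ = 0.
sup : {I : Set} → (I → ℕ∞) → ℕ∞
sup {I} x = record
  { _≼     = λ k → k ≡ 0 ⊎ ∃[ i ] (x i ≼) k
  ; 0≼     = inj₁ refl
  ; ≼-down = λ { z≤n   (inj₁ refl)    → inj₁ refl
               ; j≤k   (inj₂ (i , p)) → inj₂ (i , ℕ∞.≼-down (x i) j≤k p) }
  }

sup-upper : ∀ {I : Set} (x : I → ℕ∞) i → sup x ≥∞ x i
sup-upper x i k p = inj₂ (i , p)

sup-least : ∀ {I : Set} (x : I → ℕ∞) y → (∀ i → y ≥∞ x i) → y ≥∞ sup x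
sup-least x y ub _ (inj₁ refl)    = ℕ∞.0≼ y
sup-least x y ub k (inj₂ (i , p)) = ub i k p

-- The number of elements of a subset of A, as the supremum of the lengths of
-- its repetition-free finite lists of elements.
card : {A : Set} → Pred A 0ℓ → ℕ∞
card {A} P = sup λ (xs : Σ[ xs ∈ List A ] (Unique xs × All P xs)) →
  fin (length (proj₁ xs))

record Signature : Set₁ where
  field
    Fun   : Set
    arity : Fun → ℕ

open Signature public

data Term (F : Signature) : Set where
  var : ℕ → Term F
  fun : (f : Fun F) → Vec (Term F) (arity F f) → Term F

Subst : Signature → Set
Subst F = ℕ → Term F

module _ {F : Signature} where

  root : Term F → Maybe (Fun F)
  root (var x)    = nothing
  root (fun f ts) = just f

  mutual
    ∣_∣ : Term F → ℕ
    ∣ var x ∣    = 1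
    ∣ fun f ts ∣ = 1 + ∣ ts ∣*

    ∣_∣* : ∀ {n} → Vec (Term F) n → ℕ
    ∣ [] ∣*     = 0
    ∣ t ∷ ts ∣* = ∣ t ∣ + ∣ ts ∣*

  mutual
    infixl 8 _·_ _·*_
    _·_ : Term F → Subst F → Term F
    var x · σ    = σ x
    fun f ts · σ = fun f (ts ·* σ)

    _·*_ : ∀ {n} → Vec (Term F) n → Subst F → Vec (Term F) n
    [] ·* σ       = []
    (t ∷ ts) ·* σ = (t · σ) ∷ (ts ·* σ)

  data Pos : Term F → Set where
    ε   : ∀ {t} → Pos t
    _∙_ : ∀ {f ts} (i : Fin (arity F f)) → Pos (lookup ts i) → Pos (fun f ts)

  infixl 9 _∣_ _[_]at_
  _∣_ : (t : Term F) → Pos t → Term F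
  t ∣ ε              = t
  fun f ts ∣ (i ∙ π) = lookup ts i ∣ π

  _[_]at_ : (t : Term F) → Term F → Pos t → Term F
  t [ s ]at ε              = s
  fun f ts [ s ]at (i ∙ π) = fun f (ts [ i ]≔ (lookup ts i [ s ]at π))

  _∈V_ : ℕ → Term F → Set
  x ∈V t = Σ[ π ∈ Pos t ] t ∣ π ≡ var x

  AllProperSubterms : Pred (Term F) 0ℓ → Pred (Term F) 0ℓ
  AllProperSubterms P t = (π : Pos t) → π ≢ ε → P (t ∣ π)

  -- T(G,V) for a set G of function symbols.
  data TermOver (G : Pred (Fun F) 0ℓ) : Term F → Set where
    var : ∀ x → TermOver G (var x)
    fun : ∀ {f ts} → G f → (∀ i → TermOver G (lookup ts i)) →
          TermOver G (fun f ts)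

record Rule (F : Signature) : Set where
  constructor _⟶_
  field
    lhs : Term F
    rhs : Term F

open Rule public

-- A set of rules; finiteness is imposed where such sets are given.
Rules : Signature → Set₁
Rules F = Pred (Rule F) 0ℓ

⟪_⟫ : ∀ {F} → List (Rule F) → Rules F
⟪ R ⟫ ρ = ρ ∈ R

module _ {F : Signature} where

  IsRule : Rule F → Set
  IsRule (ℓ ⟶ r) = (∀ x → ℓ ≢ var x) × (∀ x → x ∈V r → x ∈V ℓ)

  record Step (R : Rules F) (s t : Term F) : Set where
    field
      rule     : Rule F
      rule∈R   : R rule
      pos      : Pos s
      subst    : Subst F
      matches  : s ∣ pos ≡ lhs rule · subst
      rewrites : t ≡ s [ rhs rule · subst ]at pos

    redex : Term F
    redex = lhs rule · subst

  IsRedex : Rules F → Pred (Term F) 0ℓ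
  IsRedex R t = ∃[ ρ ] ∃[ σ ] (R ρ × t ≡ lhs ρ · σ)

  NormalForm : Rules F → Pred (Term F) 0ℓ
  NormalForm R t = ¬ (∃[ u ] Step R t u)

  Innermost : Rules F → Rel (Term F) 0ℓ
  Innermost R s t =
    Σ[ st ∈ Step R s t ] AllProperSubterms (λ u → ¬ IsRedex R u) (Step.redex st)

  StepNF : (Q R : Rules F) → Rel (Term F) 0ℓ
  StepNF Q R s t =
    Σ[ st ∈ Step R s t ] AllProperSubterms (NormalForm Q) (Step.redex st)

  Innermost/ : (R₁ R₂ : Rules F) → Rel (Term F) 0ℓ
  Innermost/ R₁ R₂ s t = ∃[ s′ ] ∃[ s″ ]
    ( Star (StepNF (R₁ ∪ R₂) R₂) s s′
    × StepNF (R₁ ∪ R₂) R₁ s′ s″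
    × Star (StepNF (R₁ ∪ R₂) R₂) s″ t )

  Defined : Rules F → Pred (Fun F) 0ℓ
  Defined R f = ∃[ ρ ] (R ρ × root (lhs ρ) ≡ just f)

  data Basic (R : Rules F) : Term F → Set where
    basic : ∀ {f ts} → Defined R f →
            (∀ i → TermOver (λ g → ¬ Defined R g) (lookup ts i)) →
            Basic R (fun f ts)

-- s →ᵉ t
data Power {A : Set} (_⇒_ : Rel A 0ℓ) : ℕ → Rel A 0ℓ where
  done : ∀ {s} → Power _⇒_ 0 s s
  step : ∀ {e s u t} → s ⇒ u → Power _⇒_ e u t → Power _⇒_ (suc e) s t

-- An infinite ⇒-sequence from t has prefixes of every length, so the supremum
-- is ω in that case.
dh : {A : Set} → A → Rel A 0ℓ → ℕ∞
dh t _⇒_ = sup λ (d : ∃[ e ] ∃[ t′ ] Power _⇒_ e t t′) → fin (proj₁ d)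

irc/ : ∀ {F} (R₁ R₂ : Rules F) → ℕ → ℕ∞
irc/ R₁ R₂ n = sup λ (t : ∃[ t ] (Basic (R₁ ∪ R₂) t × ∣ t ∣ ≤ n)) →
  dh (proj₁ t) (Innermost/ R₁ R₂)

record TypeAssignment (F : Signature) : Set₁ where
  field
    Sort : Set
    dom  : (f : Fun F) → Fin (arity F f) → Sort
    cod  : Fun F → Sort

module _ {F : Signature} (τ : TypeAssignment F) where
  open TypeAssignment τ

  data HasType (Γ : ℕ → Sort) : Term F → Sort → Set where
    var : ∀ x → HasType Γ (var x) (Γ x)
    fun : ∀ {f ts} → (∀ i → HasType Γ (lookup ts i) (dom f i)) →
          HasType Γ (fun f ts) (cod f)

  WellTyped : Term F → Set
  WellTyped t = ∃[ Γ ] ∃[ α ] HasType Γ t α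

  SameType : Rule F → Set
  SameType (ℓ ⟶ r) = ∃[ Γ ] ∃[ α ] (HasType Γ ℓ α × HasType Γ r α)

record FiniteSignature : Set where
  field
    size     : ℕ
    arityFin : Fin size → ℕ

  sig : Signature
  sig = record { Fun = Fin size ; arity = arityFin }

open FiniteSignature public using (sig)

module _ (F : FiniteSignature) (R : List (Rule (sig F))) where

  -- sharp f exists only for defined f; irrelevance makes it depend on f alone.
  data ExtFun : Set where
    base  : Fun (sig F) → ExtFun
    sharp : (f : Fun (sig F)) → .(Defined ⟪ R ⟫ f) → ExtFun
    com   : ℕ → ExtFun

  Ext : Signature
  Ext = record
    { Fun   = ExtFun
    ; arity = λ { (base f) → arity (sig F) f
                ; (sharp f _) → arity (sig F) f
                ; (com n) → n }
    }

module _ {F : FiniteSignature} {R : List (Rule (sig F))} where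

  mutual
    embed : Term (sig F) → Term (Ext F R)
    embed (var x)    = var x
    embed (fun f ts) = fun (base f) (embed* ts)

    embed* : ∀ {n} → Vec (Term (sig F)) n → Vec (Term (Ext F R)) n
    embed* []       = []
    embed* (t ∷ ts) = embed t ∷ embed* ts

  defined? : ∀ f → Dec (Defined ⟪ R ⟫ f)
  defined? f = map′ find (λ (_ , ρ∈R , eq) → lose ρ∈R eq)
    (any? (λ ρ → ≡-dec Fin._≟_ (root (lhs ρ)) (just f)) R)

  infix 10 _♯
  _♯ : Term (Ext F R) → Term (Ext F R)
  fun (base f) ts ♯ with defined? f
  ... | yes d = fun (sharp f d) ts
  ... | no _  = fun (base f) ts
  t ♯ = t

module _ (F : FiniteSignature) (R : List (Rule (sig F))) where

  embeddedRules : List (Rule (Ext F R))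
  embeddedRules = List.map (λ ρ → embed (lhs ρ) ⟶ embed (rhs ρ)) R

  -- An element f♯(t₁,…,tₙ) of T♯: the arguments are terms over the original
  -- signature.
  record SharpTerm : Set where
    constructor sharpTerm
    field
      sym      : Fun (sig F)
      .defined : Defined ⟪ R ⟫ sym
      args     : Vec (Term (sig F)) (arity (sig F) sym)

  -- s♯ → Comₙ(t₁♯,…,tₙ♯)
  record DT : Set where
    constructor dt
    field
      left  : SharpTerm
      {n}   : ℕ
      right : Vec SharpTerm n

module _ {F : FiniteSignature} {R : List (Rule (sig F))} where

  ⌜_⌝ : SharpTerm F R → Term (Ext F R)
  ⌜ sharpTerm f d ts ⌝ = fun (sharp f d) (embed* ts)

  dtRule : DT F R → Rule (Ext F R)
  dtRule (dt s {n} ts) = ⌜ s ⌝ ⟶ fun (com n) (Vec.map ⌜_⌝ ts)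

record DTProblem (F : FiniteSignature) : Set where
  field
    R      : List (Rule (sig F))
    R-rule : All IsRule R
    D      : List (DT F R)
    D-rule : All (IsRule ∘ dtRule) D
    S      : List (DT F R)
    S⊆D    : S ⊆ D

-- Possibly infinite, finitely branching trees.  Finite branching is no
-- restriction: a node of a chain tree labelled with a DT whose right-hand side
-- is Comₘ(…) has at most m children.
record Tree (L : Set) : Set where
  coinductive
  field
    label    : L
    degree   : ℕ
    children : Fin degree → Tree L

open Tree public

data Node {L : Set} (T : Tree L) : Set where
  here  : Node T
  below : (j : Fin (degree T)) → Node (children T j) → Node T

subtree : ∀ {L} {T : Tree L} → Node T → Tree L
subtree {T = T} here  = T
subtree (below j v) = subtree v

module _ {F : FiniteSignature} (P : DTProblem F) where
  open DTProblem P

  𝓡 𝓓 𝓢 : Rules (Ext F R)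
  𝓡 = ⟪ embeddedRules F R ⟫
  𝓓 = ⟪ List.map dtRule D ⟫
  𝓢 = ⟪ List.map dtRule S ⟫

  -- The substitutions range over terms of the extended signature, so that Cplx is
  -- defined for every t ♯ with t over that signature.
  Label : Set
  Label = DT F R × Subst (Ext F R)

  redexOf : Label → Term (Ext F R)
  redexOf (d , μ) = ⌜ DT.left d ⌝ · μ

  record ChainNode (T : Tree Label) : Set where
    private
      d = proj₁ (label T)
      μ = proj₂ (label T)
    field
      label∈D : d ∈ D
      normal  : NormalForm 𝓡 (redexOf (label T))
      index   : Fin (degree T) → Fin (DT.n d)
      index-injective : Injective _≡_ _≡_ index
      reaches : ∀ j → Star (Innermost 𝓡) (⌜ lookup (DT.right d) (index j) ⌝ · μ)
                                         (redexOf (label (children T j)))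

  record ChainTreeFor (t : Term (Ext F R)) (T : Tree Label) : Set where
    field
      isRoot : redexOf (label T) ≡ t
      nodes  : (v : Node T) → ChainNode (subtree v)

  countS : Tree Label → ℕ∞
  countS T = card λ (v : Node T) → proj₁ (label (subtree v)) ∈ S

  Cplx : Term (Ext F R) → ℕ∞
  Cplx t = sup λ (T : ∃ (ChainTreeFor t)) → countS (proj₁ T)

  ircDT : ℕ → ℕ∞
  ircDT n = sup λ (t : ∃[ t ] (Basic ⟪ R ⟫ t × ∣ t ∣ ≤ n)) →
    Cplx (embed (proj₁ t) ♯)

{-# OPTIONS --safe #-}

-- In a derivation from a basic term f♯(…), every reachable term is a nest of compound
-- symbols around sharp calls, D-rules apply only at the roots of these calls, and R-rules
-- only inside them.  Going backwards through a finite derivation, each D-step on a call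
-- becomes the root of a chain tree whose children are the trees of the calls in its
-- right-hand side, and each R-step becomes part of an edge.  A call that gets no D-step is
-- pruned.
--
-- In (b) the arguments of the start term may contain compound and sharp symbols, while the
-- chain tree must start from a basic term over Σ, so maximal subterms with alien roots are
-- replaced by variables.  The variables are codes of the subterms, which makes the
-- replacement invertible by a substitution δ; hence it creates no redexes.

module Submission where

open import Defs
open import Algebra.Properties.CommutativeSemigroup using (x∙yz≈y∙xz)
open import Data.Empty using (⊥; ⊥-elim; ⊥-elim-irr)
open import Data.Fin.Base using (Fin; zero; suc; toℕ; fromℕ<)
open import Data.Fin.Properties using (suc-injective; toℕ<n; fromℕ<-toℕ)
open import Data.List.Base as List using (List; []; _∷_; _++_; length)
open import Data.List.Membership.Propositional using (_∈_)
open import Data.List.Membership.Propositional.Properties using (∈-map⁺; ∈-map⁻)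
open import Data.List.Properties using (length-map; length-++)
open import Data.List.Relation.Unary.All as All using (All; []; _∷_)
import Data.List.Relation.Unary.All.Properties as All
open import Data.List.Relation.Unary.AllPairs using ([]; _∷_)
open import Data.List.Relation.Unary.Unique.Propositional using (Unique)
import Data.List.Relation.Unary.Unique.Propositional.Properties as Unique
open import Data.Nat.Base using (ℕ; zero; suc; _+_; _≤_; z≤n; s≤s)
open import Data.Nat.Properties
  using (≤-refl; ≤-reflexive; ≤-trans; _<?_; n≤0⇒n≡0; m≤m+n; m≤n+m; +-mono-≤; +-assoc; +-suc;
         +-identityʳ; +-commutativeSemigroup)
open import Data.Product.Base using (Σ-syntax; ∃-syntax; _×_; _,_; proj₁; proj₂)
open import Data.Sum.Base using (inj₁; inj₂)
open import Data.Unit.Base using (⊤; tt)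
open import Data.Vec.Base as Vec using (Vec; []; _∷_; lookup; _[_]≔_)
import Data.Vec.Functional as Vector
open import Data.Vec.Properties using (map-[]≔; lookup-map; map-id)
open import Function.Base using (_∘_; id)
open import Function.Definitions using (Injective; StrictlySurjective)
open import Level using (0ℓ)
open import Relation.Binary.Construct.Closure.ReflexiveTransitive using (Star; ε; _◅_)
open import Relation.Binary.PropositionalEquality
  using (_≡_; _≢_; refl; sym; trans; cong; cong₂; subst; subst₂)
open import Relation.Nullary using (¬_; yes; no)
open import Relation.Nullary.Decidable using (recompute)
open import Relation.Unary using (Pred; _∪_; _∖_)

-- Vectors, and counting by repetition-free lists.

all-update : ∀ {A : Set} (Q : Pred A 0ℓ) {n} (xs : Vec A n) i {y} →
  (∀ j → Q (lookup xs j)) → Q y → ∀ j → Q (lookup (xs [ i ]≔ y) j)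
all-update Q (x ∷ xs) zero    q r zero    = r
all-update Q (x ∷ xs) zero    q r (suc j) = q (suc j)
all-update Q (x ∷ xs) (suc i) q r zero    = q zero
all-update Q (x ∷ xs) (suc i) q r (suc j) = all-update Q xs i (q ∘ suc) r j

-- A witness of exactly `k` elements instead of a bound on `card`: such lists can be mapped and
-- concatenated, and their lengths add up.
Counted : ∀ {A : Set} → Pred A 0ℓ → ℕ → Set
Counted Q k = ∃[ xs ] (Unique xs × All Q xs × length xs ≡ k)

none-counted : ∀ {A : Set} {Q : Pred A 0ℓ} → Counted Q 0
none-counted = [] , [] , [] , refl

map-counted : ∀ {A B : Set} {Q : Pred B 0ℓ} {f : A → B} {k} →
  Injective _≡_ _≡_ f → Counted (Q ∘ f) k → Counted Q k
map-counted {f = f} inj (xs , u , q , l) =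
  List.map f xs , Unique.map⁺ inj u , All.map⁺ q , trans (length-map f xs) l

++-counted : ∀ {A B C : Set} {Q : Pred C 0ℓ} {f : A → C} {g : B → C} {j k} →
  Injective _≡_ _≡_ f → Injective _≡_ _≡_ g → (∀ a b → f a ≢ g b) →
  Counted (Q ∘ f) j → Counted (Q ∘ g) k → Counted Q (j + k)
++-counted {f = f} {g} f-inj g-inj disjoint (xs , u , p , l) (ys , v , q , m) =
  List.map f xs ++ List.map g ys ,
  Unique.++⁺ (Unique.map⁺ f-inj u) (Unique.map⁺ g-inj v)
    (λ (a , b) → apart (∈-map⁻ f a) (∈-map⁻ g b)) ,
  All.++⁺ (All.map⁺ p) (All.map⁺ q) ,
  trans (length-++ (List.map f xs))
    (cong₂ _+_ (trans (length-map f xs) l) (trans (length-map g ys) m))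
  where
  apart : ∀ {c} → ∃[ x ] (x ∈ xs × c ≡ f x) → ∃[ y ] (y ∈ ys × c ≡ g y) → ⊥
  apart (x , _ , eq) (y , _ , eq′) = disjoint x y (trans (sym eq) eq′)

-- Uncurried, so that the nodes strictly under the root are the injective image of a single sum
-- type.
below′ : ∀ {L : Set} {T : Tree L} → Σ[ j ∈ Fin (degree T) ] Node (children T j) → Node T
below′ (j , v) = below j v

below′-injective : ∀ {L : Set} (T : Tree L) → Injective _≡_ _≡_ (below′ {T = T})
below′-injective T {i , u} {.i , .u} refl = refl

card-counted : ∀ {A : Set} {Q : Pred A 0ℓ} {k} → Counted Q k → (card Q ≼) k
card-counted (xs , u , q , l) = inj₂ ((xs , u , q) , ≤-reflexive (sym l))

-- Substitutions, redexes and innermost steps over any signature.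

module _ {F : Signature} where

  lookup-·* : ∀ {n} (ts : Vec (Term F) n) σ i → lookup (ts ·* σ) i ≡ lookup ts i · σ
  lookup-·* (t ∷ ts) σ zero    = refl
  lookup-·* (t ∷ ts) σ (suc i) = lookup-·* ts σ i

  mutual
    ·-fuse : ∀ {σ δ τ : Subst F} → (∀ x → σ x · δ ≡ τ x) → ∀ t → t · σ · δ ≡ t · τ
    ·-fuse eq (var x)    = eq x
    ·-fuse eq (fun f ts) = cong (fun f) (·*-fuse eq ts)

    ·*-fuse : ∀ {σ δ τ : Subst F} → (∀ x → σ x · δ ≡ τ x) →
      ∀ {n} (ts : Vec (Term F) n) → ts ·* σ ·* δ ≡ ts ·* τ
    ·*-fuse eq []       = refl
    ·*-fuse eq (t ∷ ts) = cong₂ _∷_ (·-fuse eq t) (·*-fuse eq ts)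

  mutual
    ·-var : ∀ (t : Term F) → t · var ≡ t
    ·-var (var x)    = refl
    ·-var (fun f ts) = cong (fun f) (·*-var ts)

    ·*-var : ∀ {n} (ts : Vec (Term F) n) → ts ·* var ≡ ts
    ·*-var []       = refl
    ·*-var (t ∷ ts) = cong₂ _∷_ (·-var t) (·*-var ts)

  redex-· : ∀ {R : Rules F} {t} δ → IsRedex R t → IsRedex R (t · δ)
  redex-· δ (ρ , σ , ρ∈R , refl) =
    ρ , (λ x → σ x · δ) , ρ∈R , ·-fuse (λ _ → refl) (lhs ρ)

  pos-· : ∀ t δ (π : Pos t) → Σ[ π′ ∈ Pos (t · δ) ]
    ((t · δ) ∣ π′ ≡ (t ∣ π) · δ × (π ≢ ε → π′ ≢ ε))
  pos-· t δ ε = ε , refl , λ ε≢ε → ⊥-elim (ε≢ε refl)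
  pos-· (fun f ts) δ (i ∙ π) =
    let π′ , eq = subst (λ u → Σ[ π′ ∈ Pos u ] (u ∣ π′ ≡ (lookup ts i ∣ π) · δ))
                    (sym (lookup-·* ts δ i))
                    (let π′ , eq , _ = pos-· (lookup ts i) δ π in π′ , eq)
    in i ∙ π′ , eq , λ _ ()

  -- Instantiation keeps redexes and their positions, so a term inherits the absence of proper
  -- redexes from its instances.
  ¬redex-below-· : ∀ {R : Rules F} t δ → AllProperSubterms (¬_ ∘ IsRedex R) (t · δ) →
    AllProperSubterms (¬_ ∘ IsRedex R) t
  ¬redex-below-· {R} t δ nr π π≢ε r with pos-· t δ π
  ... | π′ , eq , proper = nr π′ (proper π≢ε) (subst (IsRedex R) (sym eq) (redex-· δ r))

  normal⇒¬redex : ∀ {R : Rules F} {t} → NormalForm R t → ¬ IsRedex R t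
  normal⇒¬redex nf (ρ , σ , ρ∈R , eq) = nf (_ , record
    { rule = ρ ; rule∈R = ρ∈R ; pos = ε ; subst = σ ; matches = eq ; rewrites = refl })

  ¬redex⇒normal : ∀ {R : Rules F} {t} → ¬ IsRedex R t →
    AllProperSubterms (¬_ ∘ IsRedex R) t → NormalForm R t
  ¬redex⇒normal nr inner
    (_ , record { rule = ρ ; rule∈R = ρ∈R ; pos = ε ; subst = σ ; matches = eq }) =
    nr (ρ , σ , ρ∈R , eq)
  ¬redex⇒normal nr inner
    (_ , record { rule = ρ ; rule∈R = ρ∈R ; pos = i ∙ π ; subst = σ ; matches = eq }) =
    inner (i ∙ π) (λ ()) (ρ , σ , ρ∈R , eq)

  normal-star : ∀ {R : Rules F} {s t} → NormalForm R s → Star (Innermost R) s t → t ≡ s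
  normal-star nf ε              = refl
  normal-star nf ((st , _) ◅ _) = ⊥-elim (nf (_ , st))

  innermost-arg : ∀ {R : Rules F} {f} ts i {u} → Innermost R (lookup ts i) u →
    Innermost R (fun f ts) (fun f (ts [ i ]≔ u))
  innermost-arg {f = f} ts i
    (record { rule = ρ ; rule∈R = ρ∈R ; pos = π ; subst = σ ; matches = eq ; rewrites = refl }
    , inner) =
    record { rule = ρ ; rule∈R = ρ∈R ; pos = i ∙ π ; subst = σ ; matches = eq ; rewrites = refl }
    , inner

  innermost-map-arg : ∀ {R : Rules F} {f} (φ : Term F → Term F) ts i {u} →
    Innermost R (φ (lookup ts i)) (φ u) →
    Innermost R (fun f (Vec.map φ ts)) (fun f (Vec.map φ (ts [ i ]≔ u)))
  innermost-map-arg {R} {f} φ ts i {u} st =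
    subst (λ us → Innermost R (fun f (Vec.map φ ts)) (fun f us)) (sym (map-[]≔ φ ts i))
      (innermost-arg (Vec.map φ ts) i
        (subst (λ v → Innermost R v (φ u)) (sym (lookup-map i φ ts)) st))

  termOver-subterm : ∀ {G : Pred (Fun F) 0ℓ} {t : Term F} →
    TermOver G t → (π : Pos t) → TermOver G (t ∣ π)
  termOver-subterm g ε = g
  termOver-subterm (fun _ gs) (i ∙ π) = termOver-subterm (gs i) π

  termOver-⊆ : ∀ {G H : Pred (Fun F) 0ℓ} → (∀ {f} → G f → H f) →
    ∀ {t : Term F} → TermOver G t → TermOver H t
  termOver-⊆ G⊆H (var x)    = var x
  termOver-⊆ G⊆H (fun g gs) = fun (G⊆H g) (termOver-⊆ G⊆H ∘ gs)

  ∈V-arg : ∀ {x} {f} {ts : Vec (Term F) (arity F f)} i → x ∈V lookup ts i → x ∈V fun f ts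
  ∈V-arg i (π , eq) = i ∙ π , eq

-- Embedding into the extended signature.

module _ {F : FiniteSignature} {R : List (Rule (sig F))} where

  lookup-embed* : ∀ {n} (ts : Vec (Term (sig F)) n) i →
    lookup (embed* {R = R} ts) i ≡ embed (lookup ts i)
  lookup-embed* (t ∷ ts) zero    = refl
  lookup-embed* (t ∷ ts) (suc i) = lookup-embed* ts i

  ∈V-embed : ∀ {x} t → x ∈V t → x ∈V embed {R = R} t
  ∈V-embed (var y) (ε , eq) = ε , cong embed eq
  ∈V-embed (fun f ts) (i ∙ π , eq) = ∈V-arg {F = Ext F R} {f = base f} i
    (subst (_ ∈V_) (sym (lookup-embed* ts i)) (∈V-embed (lookup ts i) (π , eq)))
  ∈V-embed (fun f ts) (ε , ())

-- Weighted derivations and the shape of reachable terms.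

module Simulation {F : FiniteSignature} (P : DTProblem F) where
  open DTProblem P

  E : Signature
  E = Ext F R

  Rest : Rules E
  Rest = (𝓓 P ∖ 𝓢 P) ∪ 𝓡 P

  _⇒_ : Term E → Term E → Set
  _⇒_ = Innermost/ (𝓢 P) Rest

  Constructor : Pred (Fun E) 0ℓ
  Constructor f = ¬ Defined (𝓓 P ∪ 𝓡 P) f

  ¬RedexBelow : Pred (Term E) 0ℓ
  ¬RedexBelow = AllProperSubterms (¬_ ∘ IsRedex (𝓡 P))

  -- Weights only bound counts from below: members of S may be light too.
  data Weight (d : DT F R) : ℕ → Set where
    light : Weight d 0
    heavy : d ∈ S → Weight d 1

  data Weighted : Rule E → ℕ → Set where
    rewriting : ∀ {f ls r} → (fun f ls ⟶ r) ∈ R → Weighted (embed (fun f ls) ⟶ embed r) 0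
    tuple     : ∀ {d c} → d ∈ D → Weight d c → Weighted (dtRule d) c

  𝓡-weighted : ∀ {ρ} → 𝓡 P ρ → Weighted ρ 0
  𝓡-weighted ρ∈ with ∈-map⁻ _ ρ∈
  ... | (var x ⟶ r)    , m , refl = ⊥-elim (proj₁ (All.lookup R-rule m) x refl)
  ... | (fun f ls ⟶ r) , m , refl = rewriting m

  𝓢-weighted : ∀ {ρ} → 𝓢 P ρ → Weighted ρ 1
  𝓢-weighted ρ∈ with ∈-map⁻ _ ρ∈
  ... | d , d∈S , refl = tuple (S⊆D d∈S) (heavy d∈S)

  rest-weighted : ∀ {ρ} → Rest ρ → Weighted ρ 0
  rest-weighted (inj₂ ρ∈) = 𝓡-weighted ρ∈
  rest-weighted (inj₁ (ρ∈ , _)) with ∈-map⁻ _ ρ∈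
  ... | d , d∈D , refl = tuple d∈D light

  weighted-∈ : ∀ {ρ c} → Weighted ρ c → (𝓓 P ∪ 𝓡 P) ρ
  weighted-∈ (rewriting m) = inj₂ (∈-map⁺ _ m)
  weighted-∈ (tuple d∈D _) = inj₁ (∈-map⁺ _ d∈D)

  -- Left-hand sides are never variables, so the root of each instance is a defined symbol.
  constructor-¬redex : ∀ {ρ c σ} → Weighted ρ c → ¬ TermOver Constructor (lhs ρ · σ)
  constructor-¬redex w@(rewriting _) (fun con _) = con (_ , weighted-∈ w , refl)
  constructor-¬redex w@(tuple _ _)   (fun con _) = con (_ , weighted-∈ w , refl)

  constructor-no-match : ∀ {ρ c σ t} → Weighted ρ c → TermOver Constructor t → (π : Pos t) →
    t ∣ π ≢ lhs ρ · σ
  constructor-no-match {σ = σ} w con π eq = constructor-¬redex {σ = σ} w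
    (subst (TermOver {F = E} Constructor) eq (termOver-subterm {F = E} con π))

  -- Steps with R- and D-rules alike; c is 1 for the rules that count, those from S.
  record WStep (c : ℕ) (s t : Term E) : Set where
    constructor wstep
    field
      {rule}   : Rule E
      weighted : Weighted rule c
      pos      : Pos s
      {σ}      : Subst E
      matches  : s ∣ pos ≡ lhs rule · σ
      rewrites : t ≡ s [ rhs rule · σ ]at pos
      inner    : ¬RedexBelow (lhs rule · σ)

  toWStep : ∀ {R′ c s t} → (∀ {ρ} → R′ ρ → Weighted ρ c) →
    StepNF (𝓢 P ∪ Rest) R′ s t → WStep c s t
  toWStep w (st , nf) = record
    { weighted = w (Step.rule∈R st) ; pos = Step.pos st ; matches = Step.matches st
    ; rewrites = Step.rewrites st
    -- Only the absence of R-redexes is retained: labels of chain nodes and innermost R-steps refer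
    -- to R alone.
    ; inner = λ π π≢ε → λ { (ρ , σ , ρ∈ , eq) →
        normal⇒¬redex (nf π π≢ε) (ρ , σ , inj₂ (inj₂ ρ∈) , eq) } }

  -- The arguments of the sharp calls in a derivation: no D-rule applies inside them, and
  -- a subterm whose root is a compound or sharp symbol contains no redex at all.
  data Arg : Term E → Set where
    con : ∀ {t} → TermOver Constructor t → Arg t
    app : ∀ {f ts} → (∀ i → Arg (lookup ts i)) → Arg (fun (base f) ts)

  arg-subterm : ∀ {f ts} → Arg (fun f ts) → ∀ i → Arg (lookup ts i)
  arg-subterm (con (fun _ gs)) i = con (gs i)
  arg-subterm (app as)         i = as i

  arg-var : ∀ {x} t {σ} → Arg (t · σ) → x ∈V t → Arg (σ x)
  arg-var (var x) a (ε , refl) = a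
  arg-var (fun f ts) {σ} a (i ∙ π , eq) =
    arg-var (lookup ts i) (subst Arg (lookup-·* ts σ i) (arg-subterm a i)) (π , eq)
  arg-var (fun f ts) a (ε , ())

  mutual
    arg-embed : ∀ t {σ} → (∀ x → x ∈V t → Arg (σ x)) → Arg (embed t · σ)
    arg-embed (var x)    a = a x (ε , refl)
    arg-embed (fun f ts) a = app (arg-embed* ts λ i x x∈ → a x (∈V-arg {F = sig F} {f = f} i x∈))

    arg-embed* : ∀ {n} (ts : Vec (Term (sig F)) n) {σ} →
      (∀ i x → x ∈V lookup ts i → Arg (σ x)) → ∀ i → Arg (lookup (embed* ts ·* σ) i)
    arg-embed* (t ∷ ts) a zero    = arg-embed t (a zero)
    arg-embed* (t ∷ ts) a (suc i) = arg-embed* ts (a ∘ suc) i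

  -- No rule matches inside a constructor part, and a tuple cannot match at a base root. So the rule
  -- is from R, and its right-hand side places only base symbols above subterms of the redex.
  arg-step : ∀ {c s t} → Arg s → WStep c s t → c ≡ 0 × Arg t
  arg-step (con con′) (wstep w π {σ} eq _ _) = ⊥-elim (constructor-no-match {σ = σ} w con′ π eq)
  arg-step (app {ts = ts} as) (wstep w (i ∙ π) eq refl inner)
    with arg-step (as i) (wstep w π eq refl inner)
  ... | refl , a = refl , app (all-update Arg ts i as a)
  arg-step (app as) (wstep (rewriting {f} {ls} {r} m) ε refl refl inner) =
    refl , arg-embed r λ x x∈r →
      arg-var (embed (fun f ls)) (app as) (∈V-embed (fun f ls) (proj₂ (All.lookup R-rule m) x x∈r))
  arg-step (app as) (wstep (tuple {d} _ _) ε () _ _)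

  sharp-¬redex : ∀ {f} .{d : Defined ⟪ R ⟫ f} {ts} → ¬ IsRedex (𝓡 P) (fun (sharp f d) ts)
  sharp-¬redex (ρ , σ , ρ∈ , eq) with ∈-map⁻ _ ρ∈
  sharp-¬redex (ρ , σ , ρ∈ , eq) | (var x ⟶ r) , m , refl = proj₁ (All.lookup R-rule m) x refl
  sharp-¬redex (ρ , σ , ρ∈ , ()) | (fun f ls ⟶ r) , m , refl

  com-undefined : ∀ {n} → ¬ Defined (𝓓 P ∪ 𝓡 P) (com n)
  com-undefined (ρ , inj₁ ρ∈ , eq) with ∈-map⁻ _ ρ∈
  com-undefined (ρ , inj₁ ρ∈ , ()) | d , _ , refl
  com-undefined (ρ , inj₂ ρ∈ , eq) with ∈-map⁻ _ ρ∈
  com-undefined (ρ , inj₂ ρ∈ , ()) | (var _ ⟶ _) , _ , refl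
  com-undefined (ρ , inj₂ ρ∈ , ()) | (fun _ _ ⟶ _) , _ , refl

  arg-rest : ∀ {s t} → Arg s → Star (StepNF (𝓢 P ∪ Rest) Rest) s t → Arg t
  arg-rest a ε          = a
  arg-rest a (st ◅ sts) = arg-rest (proj₂ (arg-step a (toWStep rest-weighted st))) sts

  -- S-steps have weight 1, but `arg-step` forces weight 0. This settles basic terms whose root is
  -- an original symbol.
  arg-dh : ∀ {s k} → Arg s → (dh s _⇒_ ≼) k → k ≡ 0
  arg-dh a (inj₁ k≡0)                    = k≡0
  arg-dh a (inj₂ ((_ , _ , done) , k≤0)) = n≤0⇒n≡0 k≤0
  arg-dh a (inj₂ ((_ , _ , step (_ , _ , r , st , _) _) , _))
    with arg-step (arg-rest a r) (toWStep 𝓢-weighted st)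
  ... | () , _

  data State : Term E → Set where
    call : ∀ {f} .{d : Defined ⟪ R ⟫ f} {ts} → (∀ i → Arg (lookup ts i)) → State (fun (sharp f d) ts)
    com  : ∀ {n ts} → (∀ i → State (lookup ts i)) → State (fun (com n) ts)

  call-rhs : ∀ {n} (ws : Vec (SharpTerm F R) n) {σ} →
    (∀ i x → x ∈V ⌜ lookup ws i ⌝ → Arg (σ x)) → ∀ i → State (lookup (Vec.map ⌜_⌝ ws ·* σ) i)
  call-rhs (sharpTerm f d us ∷ ws) a zero =
    call (arg-embed* us λ i x x∈ → a zero x
      (∈V-arg {F = E} {f = sharp f d} i
        (subst (x ∈V_) (sym (lookup-embed* us i)) (∈V-embed (lookup us i) x∈))))
  call-rhs (w ∷ ws) a (suc i) = call-rhs ws (a ∘ suc) i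

  -- A tuple turns a call into a compound of calls, whose arguments are built by base symbols from
  -- subterms of the old arguments. All other steps take place inside an argument or below a
  -- compound.
  state-step : ∀ {c s t} → State s → WStep c s t → State t
  state-step (call {ts = ts} as) (wstep w (i ∙ π) eq refl inner) =
    call (all-update Arg ts i as (proj₂ (arg-step (as i) (wstep w π eq refl inner))))
  state-step (call as) (wstep (rewriting _) ε () _ _)
  state-step (call as) (wstep (tuple {dt (sharpTerm f _ ls) ws} d∈D _) ε {σ} refl refl _) =
    com (call-rhs ws λ i x x∈ →
      var-arg (proj₂ (All.lookup D-rule d∈D) x
        (∈V-arg {F = E} {f = com _} i (subst (x ∈V_) (sym (lookup-map i ⌜_⌝ ws)) x∈))))
    where
    var-arg : ∀ {x} → x ∈V fun _ (embed* ls) → Arg (σ x)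
    var-arg (i ∙ π , eq) =
      arg-var (lookup (embed* ls) i) (subst Arg (lookup-·* (embed* ls) σ i) (as i)) (π , eq)
    var-arg (ε , ())
  state-step (com {ts = ts} ss) (wstep w (i ∙ π) eq refl inner) =
    com (all-update State ts i ss (state-step (ss i) (wstep w π eq refl inner)))
  state-step (com ss) (wstep (rewriting _) ε () _ _)
  state-step (com ss) (wstep (tuple _ _) ε () _ _)

  -- The chain tree is built for the φ-image of the start term.  Since φ t · δ ≡ t, a redex
  -- in φ t gives one in t, so normal forms and innermost steps are preserved by φ even
  -- for rules that are not left-linear.
  module Image (φ : Term E → Term E) (δ : Subst E)
    (φ-base : ∀ f ts → φ (fun (base f) ts) ≡ fun (base f) (Vec.map φ ts))
    (φ-· : ∀ t → φ t · δ ≡ t) where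

    mutual
      -- `φ` commutes with base symbols, so an instance of an R-rule under `σ` is sent to an
      -- instance of the same rule under `φ ∘ σ`.
      φ-embed : ∀ t σ → φ (embed t · σ) ≡ embed t · (φ ∘ σ)
      φ-embed (var x)    σ = refl
      φ-embed (fun f ts) σ = trans (φ-base f _) (cong (fun (base f)) (φ-embed* ts σ))

      φ-embed* : ∀ {n} (ts : Vec (Term (sig F)) n) σ →
        Vec.map φ (embed* ts ·* σ) ≡ embed* ts ·* (φ ∘ σ)
      φ-embed* []       σ = refl
      φ-embed* (t ∷ ts) σ = cong₂ _∷_ (φ-embed t σ) (φ-embed* ts σ)

    map-φ-·* : ∀ {n} (ts : Vec (Term E) n) → Vec.map φ ts ·* δ ≡ ts
    map-φ-·* []       = refl
    map-φ-·* (t ∷ ts) = cong₂ _∷_ (φ-· t) (map-φ-·* ts)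

    ¬redexBelow-φ : ∀ t σ → ¬RedexBelow (t · σ) → ¬RedexBelow (t · (φ ∘ σ))
    ¬redexBelow-φ t σ nr = ¬redex-below-· (t · (φ ∘ σ)) δ
      (subst ¬RedexBelow (sym (·-fuse (φ-· ∘ σ) t)) nr)

    φ-step : ∀ {c s t} → Arg s → WStep c s t → Innermost (𝓡 P) (φ s) (φ t)
    φ-step (con con′) (wstep w π {σ} eq _ _) = ⊥-elim (constructor-no-match {σ = σ} w con′ π eq)
    φ-step (app {f} {ts} as) (wstep w (i ∙ π) eq refl inner) =
      subst₂ (Innermost (𝓡 P)) (sym (φ-base f ts)) (sym (φ-base f _))
        (innermost-map-arg φ ts i (φ-step (as i) (wstep w π eq refl inner)))
    φ-step (app as) (wstep (rewriting {f} {ls} {r} m) ε {σ} refl refl inner) =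
      record { rule = embed (fun f ls) ⟶ embed r ; rule∈R = ∈-map⁺ _ m ; pos = ε ; subst = φ ∘ σ
             ; matches = φ-embed (fun f ls) σ ; rewrites = φ-embed r σ } ,
      ¬redexBelow-φ (embed (fun f ls)) σ inner
    φ-step (app as) (wstep (tuple {d} _ _) ε () _ _)

    -- Growing chain trees backwards along a derivation.

    Tracked : Tree (Label P) → ℕ → Set
    Tracked T = Counted λ (v : Node T) → proj₁ (label (subtree v)) ∈ S

    -- Harvest t k: chain trees with k nodes from S in total grow from calls in t.
    data Harvest : Term E → ℕ → Set
    data Harvests : ∀ {n} → Vec (Term E) n → ℕ → Set

    data Harvest where
      none : ∀ {t} → Harvest t 0
      tree : ∀ {f} .{d : Defined ⟪ R ⟫ f} {ts k} (T : Tree (Label P)) →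
        -- The call only has to reach the root of `T`, which leaves room for prepending earlier
        -- R-steps.
        Star (Innermost (𝓡 P)) (fun (sharp f d) (Vec.map φ ts)) (redexOf P (label T)) →
        (∀ (v : Node T) → ChainNode P (subtree v)) → Tracked T k → Harvest (fun (sharp f d) ts) k
      com  : ∀ {n ts k} → Harvests ts k → Harvest (fun (com n) ts) k

    data Harvests where
      []  : Harvests [] 0
      _∷_ : ∀ {n t j k} {ts : Vec (Term E) n} → Harvest t j → Harvests ts k → Harvests (t ∷ ts) (j + k)

    nones : ∀ {n} (ts : Vec (Term E) n) → Harvests ts 0
    nones []       = []
    nones (t ∷ ts) = none ∷ nones ts

    -- What a chain node needs below its root: the trees of the calls `ws` that were not pruned,
    -- with `index` telling which call each tree belongs to.
    record Forest {n} (ws : Vec (SharpTerm F R) n) (σ : Subst E) (k : ℕ) : Set where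
      field
        width     : ℕ
        trees     : Fin width → Tree (Label P)
        index     : Fin width → Fin n
        injective : Injective _≡_ _≡_ index
        reaches   : ∀ j → Star (Innermost (𝓡 P)) (⌜ lookup ws (index j) ⌝ · σ)
                                                 (redexOf P (label (trees j)))
        nodes     : ∀ j (v : Node (trees j)) → ChainNode P (subtree v)
        tracked   : Counted (λ ((j , v) : Σ[ j ∈ Fin width ] Node (trees j)) →
                      proj₁ (label (subtree v)) ∈ S) k

    forest : ∀ {n} (ws : Vec (SharpTerm F R) n) {σ k} →
      Harvests (Vec.map ⌜_⌝ ws ·* σ) k → Forest ws (φ ∘ σ) k
    forest [] [] = record
      { width = 0 ; trees = λ () ; index = λ () ; injective = λ { {()} }
      ; reaches = λ () ; nodes = λ () ; tracked = none-counted }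
    -- A pruned call yields no child, so `index` skips its place.
    forest (sharpTerm f d us ∷ ws) (none ∷ hs) = record
      { width = width ; trees = trees ; index = suc ∘ index
      ; injective = injective ∘ suc-injective
      ; reaches = reaches ; nodes = nodes ; tracked = tracked }
      where open Forest (forest ws hs)
    forest (sharpTerm f d us ∷ ws) {σ} (tree T r ns c ∷ hs) = record
      { width = suc width ; trees = T Vector.∷ trees
      ; index = zero Vector.∷ (suc ∘ index)
      ; injective = λ { {zero} {zero} _ → refl
                      ; {suc i} {suc j} eq → cong suc (injective (suc-injective eq)) }
      ; reaches = λ { zero → subst (λ ts → Star (Innermost (𝓡 P)) (fun (sharp f d) ts) _)
                               (φ-embed* us σ) r
                    ; (suc j) → reaches j }
      ; nodes = λ { zero → ns ; (suc j) → nodes j }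
      ; tracked = ++-counted {f = zero ,_} {g = λ (j , v) → suc j , v}
          (λ { refl → refl }) (λ { refl → refl }) (λ _ _ ()) c tracked }
      where open Forest (forest ws hs)

    plant : ∀ {n} {ws : Vec (SharpTerm F R) n} {σ k} → Label P → Forest ws σ k → Tree (Label P)
    plant l fo .label    = l
    plant l fo .degree   = Forest.width fo
    plant l fo .children = Forest.trees fo

    plant-nodes : ∀ {d σ k} → d ∈ D → NormalForm (𝓡 P) (redexOf P (d , σ)) →
      (fo : Forest (DT.right d) σ k) → (v : Node (plant (d , σ) fo)) → ChainNode P (subtree v)
    plant-nodes d∈D nf fo here = record
      { label∈D = d∈D ; normal = nf ; index = index ; index-injective = injective
      ; reaches = reaches }
      where open Forest fo
    plant-nodes d∈D nf fo (below j v) = Forest.nodes fo j v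

    plant-tracked : ∀ {d σ c k} → Weight d c → (fo : Forest (DT.right d) σ k) →
      Tracked (plant (d , σ) fo) (c + k)
    plant-tracked {d} {σ} light fo =
      map-counted {f = below′} (below′-injective (plant (d , σ) fo)) (Forest.tracked fo)
    plant-tracked {d} {σ} (heavy d∈S) fo =
      ++-counted {f = λ (_ : ⊤) → here} {g = below′} (λ _ → refl)
        (below′-injective (plant (d , σ) fo)) (λ _ _ ())
        (tt ∷ [] , [] ∷ [] , d∈S ∷ [] , refl) (Forest.tracked fo)

    harvests-update : ∀ {n} (ts : Vec (Term E) n) i {u c k} →
      (∀ {j} → Harvest u j → Harvest (lookup ts i) (c + j)) →
      Harvests (ts [ i ]≔ u) k → Harvests ts (c + k)
    harvests-update (t ∷ ts) zero {c = c} f (_∷_ {j = j} {k} h hs) =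
      subst (Harvests (t ∷ ts)) (+-assoc c j k) (f h ∷ hs)
    harvests-update (t ∷ ts) (suc i) {c = c} f (_∷_ {j = j} {k} h hs) =
      subst (Harvests (t ∷ ts)) (x∙yz≈y∙xz +-commutativeSemigroup j c k) (h ∷ harvests-update ts i f hs)

    -- A pruned compound amounts to a compound all of whose components are pruned.
    com-harvests : ∀ {n ts k} → Harvest (fun (com n) ts) k → Harvests ts k
    com-harvests none     = nones _
    com-harvests (com hs) = hs

    harvest-step : ∀ {c s t} → State s → WStep c s t → ∀ {k} → Harvest t k → Harvest s (c + k)
    harvest-step (com {n} {ts} ss) (wstep w (i ∙ π) eq refl inner) h =
      com (harvests-update ts i (harvest-step (ss i) (wstep w π eq refl inner)) (com-harvests h))
    harvest-step (com ss) (wstep (rewriting _) ε () _ _)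
    harvest-step (com ss) (wstep (tuple _ _) ε () _ _)
    harvest-step (call as) (wstep (rewriting _) ε () _ _)
    harvest-step (call as)
      (wstep (tuple {dt (sharpTerm f d ls) ws} d∈D w) ε {σ} refl refl inner) h =
      tree (plant _ fo)
        (subst (Star (Innermost (𝓡 P)) (fun (sharp f d) (Vec.map φ _)))
          (cong (fun (sharp f d)) (φ-embed* ls σ)) ε)
        -- The redex of the tuple has no R-redex below its root by `inner`, and its sharp root
        -- excludes one at the top.
        (plant-nodes d∈D (¬redex⇒normal sharp-¬redex (¬redexBelow-φ ⌜ sharpTerm f d ls ⌝ σ inner)) fo)
        (plant-tracked w fo)
      where fo = forest ws (com-harvests h)
    harvest-step (call {ts = ts} as) (wstep w (i ∙ π) eq refl inner) h
      -- The step lies inside an argument and so has weight 0: a pruned call stays pruned, and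
      -- otherwise the step extends the path to the root of the tree.
      with arg-step (as i) (wstep w π eq refl inner) | φ-step (as i) (wstep w π eq refl inner) | h
    ... | refl , _ | st | none = none
    ... | refl , _ | st | tree T r ns c = tree T (innermost-map-arg φ ts i st ◅ r) ns c

    -- The invariant travels forwards along the derivation while harvests are pulled backwards,
    -- hence the pair of a state and a function.
    harvest-rest : ∀ {s t} → State s → Star (StepNF (𝓢 P ∪ Rest) Rest) s t →
      State t × (∀ {k} → Harvest t k → Harvest s k)
    harvest-rest s ε = s , id
    harvest-rest s (st ◅ sts) =
      let w       = toWStep rest-weighted st
          t , h   = harvest-rest (state-step s w) sts
      in t , harvest-step s w ∘ h

    harvest-power : ∀ {e s t} → State s → Power _⇒_ e s t → Harvest s e
    harvest-power s done = none
    harvest-power s (step (_ , _ , r , st , r′) p) =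
      let t , h   = harvest-rest s r
          w       = toWStep 𝓢-weighted st
          t′ , h′ = harvest-rest (state-step t w) r′
      in h (harvest-step t w (h′ (harvest-power t′ p)))

    -- Applying `δ` gives back the constructor arguments, which contain no redex. Normality makes
    -- the path from the start term to the root of its tree empty, so the tree is rooted at the
    -- start term itself.
    call-normal : ∀ {f} .{d : Defined ⟪ R ⟫ f} {ts} → (∀ i → TermOver Constructor (lookup ts i)) →
      NormalForm (𝓡 P) (fun (sharp f d) (Vec.map φ ts))
    call-normal {f} {d} {ts} cs = ¬redex⇒normal sharp-¬redex
      (¬redex-below-· (fun (sharp f d) (Vec.map φ ts)) δ
        (subst (λ us → ¬RedexBelow (fun (sharp f d) us)) (sym (map-φ-·* ts)) below-call))
      where
      below-call : ¬RedexBelow (fun (sharp f d) ts)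
      below-call ε       ε≢ε _ = ε≢ε refl
      below-call (i ∙ π) _ (ρ , σ , ρ∈ , eq) =
        constructor-no-match {σ = σ} (𝓡-weighted ρ∈) (cs i) π eq

    harvest-Cplx : ∀ {f} .{d : Defined ⟪ R ⟫ f} {ts k} → (∀ i → TermOver Constructor (lookup ts i)) →
      Harvest (fun (sharp f d) ts) k → (Cplx P (fun (sharp f d) (Vec.map φ ts)) ≼) k
    harvest-Cplx cs none = inj₁ refl
    harvest-Cplx cs (tree T r ns c) =
      inj₂ ((T , record { isRoot = normal-star (call-normal cs) r ; nodes = ns }) , card-counted c)

    Cplx≥dh : ∀ {f} .{d : Defined ⟪ R ⟫ f} {ts} → (∀ i → TermOver Constructor (lookup ts i)) →
      Cplx P (fun (sharp f d) (Vec.map φ ts)) ≥∞ dh (fun (sharp f d) ts) _⇒_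
    Cplx≥dh cs _ (inj₁ refl) = inj₁ refl
    Cplx≥dh cs k (inj₂ ((e , _ , p) , k≤e)) =
      ℕ∞.≼-down (Cplx P _) k≤e (harvest-Cplx cs (harvest-power (call (con ∘ cs)) p))

-- Enumerating pairs and terms by natural numbers.

next : ℕ × ℕ → ℕ × ℕ
next (zero  , b) = suc b , zero
next (suc a , b) = a , suc b

-- Walks along the antidiagonals of ℕ × ℕ.
unpair : ℕ → ℕ × ℕ
unpair zero    = zero , zero
unpair (suc n) = next (unpair n)

unpair-surjective : StrictlySurjective _≡_ unpair
unpair-surjective (a , b) = from-axis b (on-axis (b + a))
  where
  -- `b` applications of `next` lead from `(b + a , 0)` to `(a , b)`.
  from-axis : ∀ {a} b → ∃[ n ] unpair n ≡ (b + a , 0) → ∃[ n ] unpair n ≡ (a , b)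
  from-axis zero    p = p
  from-axis {a} (suc b) (n , eq) =
    let m , eq′ = from-axis {suc a} b (n , trans eq (cong (_, 0) (sym (+-suc b a))))
    in suc m , cong next eq′

  -- From the end `(0 , a)` of an antidiagonal, `next` jumps to the start `(suc a , 0)` of the
  -- following one.
  on-axis : ∀ a → ∃[ n ] unpair n ≡ (a , 0)
  on-axis zero    = 0 , refl
  on-axis (suc a) =
    let n , eq = from-axis a (subst (λ c → ∃[ n ] unpair n ≡ (c , 0)) (sym (+-identityʳ a)) (on-axis a))
    in suc n , cong next eq

module EnumerateTerms {F : Signature} (symbol : ℕ → Fun F)
  (symbol-surjective : StrictlySurjective _≡_ symbol) where

  -- depth is fuel; it is itself encoded alongside the term in enumerate.
  mutual
    decode : (depth : ℕ) → ℕ → Term F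
    decode zero    n = var n
    decode (suc d) n = decodeRoot d (unpair n)

    decodeRoot : (depth : ℕ) → ℕ × ℕ → Term F
    decodeRoot d (zero  , x) = var x
    decodeRoot d (suc a , b) = fun (symbol a) (decode* d b)

    decode* : (depth : ℕ) → ∀ {k} → ℕ → Vec (Term F) k
    decode* d {zero}  n = []
    decode* d {suc k} n = decode d (proj₁ (unpair n)) ∷ decode* d (proj₂ (unpair n))

  mutual
    -- The code has to work for every sufficiently large depth, since arguments of different sizes
    -- are all decoded with the same fuel.
    decode-covers : ∀ t → ∃[ n ] (∀ {d} → ∣ t ∣ ≤ d → decode d n ≡ t)
    decode-covers (var x) =
      let n , eq = unpair-surjective (zero , x)
      in n , λ { {suc d} _ → cong (decodeRoot d) eq }
    decode-covers (fun f ts) with symbol-surjective f | decode*-covers ts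
    ... | a , refl | m , eq =
      let n , eq′ = unpair-surjective (suc a , m)
      in n , λ { {suc d} (s≤s le) → trans (cong (decodeRoot d) eq′) (cong (fun f) (eq le)) }

    decode*-covers : ∀ {k} (ts : Vec (Term F) k) → ∃[ n ] (∀ {d} → ∣ ts ∣* ≤ d → decode* d n ≡ ts)
    decode*-covers []       = 0 , λ _ → refl
    decode*-covers (t ∷ ts) =
      let m , eq   = decode-covers t
          m′ , eq′ = decode*-covers ts
          n , eq″  = unpair-surjective (m , m′)
      in n , λ {d} le → cong₂ _∷_
        (trans (cong (decode d ∘ proj₁) eq″) (eq (≤-trans (m≤m+n _ _) le)))
        (trans (cong (λ p → decode* d (proj₂ p)) eq″) (eq′ (≤-trans (m≤n+m _ _) le)))

  enumerate : ℕ → Term F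
  enumerate n = let d , m = unpair n in decode d m

  enumerate-surjective : StrictlySurjective _≡_ enumerate
  enumerate-surjective t =
    let m , eq  = decode-covers t
        n , eq′ = unpair-surjective (∣ t ∣ , m)
    in n , trans (cong (λ (d , m) → decode d m) eq′) (eq ≤-refl)

-- Coding extended terms by variables over the original signature.

module _ {F : FiniteSignature} {R : List (Rule (sig F))} where

  -- A total substitute for `sharp`; the default `com 0` does no harm, as the enumeration of symbols
  -- may repeat.
  sharp? : Fun (sig F) → ExtFun F R
  sharp? f with defined? {R = R} f
  ... | yes d = sharp f d
  ... | no _  = com 0

  sharp?-sharp : ∀ f .(d : Defined ⟪ R ⟫ f) → sharp? f ≡ sharp f d
  sharp?-sharp f d with defined? {R = R} f
  ... | yes _ = refl
  ... | no ¬d = ⊥-elim-irr (¬d d)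

  finSymbol : (Fin (FiniteSignature.size F) → ExtFun F R) → ℕ → ExtFun F R
  finSymbol g i with i <? FiniteSignature.size F
  ... | yes i<size = g (fromℕ< i<size)
  ... | no  _      = com 0

  finSymbol-toℕ : ∀ g f → finSymbol g (toℕ f) ≡ g f
  finSymbol-toℕ g f with toℕ f <? FiniteSignature.size F
  ... | yes i<size = cong g (fromℕ<-toℕ f i<size)
  ... | no  i≮size = ⊥-elim (i≮size (toℕ<n f))

  symbolOf : ℕ × ℕ → ExtFun F R
  symbolOf (0 , i)           = finSymbol base i
  symbolOf (1 , i)           = finSymbol sharp? i
  symbolOf (suc (suc _) , n) = com n

  symbol-surjective : StrictlySurjective _≡_ (symbolOf ∘ unpair)
  symbol-surjective g =
    let p , eq  = preimage g
        n , eq′ = unpair-surjective p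
    in n , trans (cong symbolOf eq′) eq
    where
    preimage : ∀ g → ∃[ p ] symbolOf p ≡ g
    preimage (base f)    = (0 , toℕ f) , finSymbol-toℕ base f
    preimage (sharp f d) = (1 , toℕ f) , trans (finSymbol-toℕ sharp? f) (sharp?-sharp f d)
    preimage (com n)     = (2 , n) , refl

  open EnumerateTerms {Ext F R} (symbolOf ∘ unpair) symbol-surjective

  δ : Subst (Ext F R)
  δ = enumerate

  code : Term (Ext F R) → ℕ
  code t = proj₁ (enumerate-surjective t)

  δ-code : ∀ t → δ (code t) ≡ t
  δ-code t = proj₂ (enumerate-surjective t)

  -- Replaces each maximal subterm whose root is not in the original signature by the
  -- variable that δ maps back to it.
  mutual
    strip : Term (Ext F R) → Term (sig F)
    strip (var x)              = var (code (var x))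
    strip (fun (base f) ts)    = fun f (strip* ts)
    strip (fun (sharp f d) ts) = var (code (fun (sharp f d) ts))
    strip (fun (com n) ts)     = var (code (fun (com n) ts))

    strip* : ∀ {n} → Vec (Term (Ext F R)) n → Vec (Term (sig F)) n
    strip* []       = []
    strip* (t ∷ ts) = strip t ∷ strip* ts

  lookup-strip* : ∀ {n} (ts : Vec (Term (Ext F R)) n) i → lookup (strip* ts) i ≡ strip (lookup ts i)
  lookup-strip* (t ∷ ts) zero    = refl
  lookup-strip* (t ∷ ts) (suc i) = lookup-strip* ts i

  embed*-strip* : ∀ {n} (ts : Vec (Term (Ext F R)) n) →
    embed* {R = R} (strip* ts) ≡ Vec.map (embed ∘ strip) ts
  embed*-strip* []       = refl
  embed*-strip* (t ∷ ts) = cong (embed (strip t) ∷_) (embed*-strip* ts)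

  mutual
    strip-δ : ∀ t → embed (strip t) · δ ≡ t
    strip-δ (var x)              = δ-code _
    strip-δ (fun (base f) ts)    = cong (fun (base f)) (strip*-δ ts)
    strip-δ (fun (sharp f d) ts) = δ-code _
    strip-δ (fun (com n) ts)     = δ-code _

    strip*-δ : ∀ {n} (ts : Vec (Term (Ext F R)) n) → embed* (strip* ts) ·* δ ≡ ts
    strip*-δ []       = refl
    strip*-δ (t ∷ ts) = cong₂ _∷_ (strip-δ t) (strip*-δ ts)

  mutual
    strip-size : ∀ t → ∣ strip t ∣ ≤ ∣ t ∣
    strip-size (var x)              = ≤-refl
    strip-size (fun (base f) ts)    = s≤s (strip*-size ts)
    strip-size (fun (sharp f d) ts) = s≤s z≤n
    strip-size (fun (com n) ts)     = s≤s z≤n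

    strip*-size : ∀ {n} (ts : Vec (Term (Ext F R)) n) → ∣ strip* ts ∣* ≤ ∣ ts ∣*
    strip*-size []       = z≤n
    strip*-size (t ∷ ts) = +-mono-≤ (strip-size t) (strip*-size ts)

  strip-termOver : ∀ {G : Pred (Fun (sig F)) 0ℓ} {H : Pred (ExtFun F R) 0ℓ} →
    (∀ {f} → H (base f) → G f) → ∀ {t} → TermOver H t → TermOver G (strip t)
  strip-termOver H⇒G (var x)                     = var _
  strip-termOver {G} H⇒G (fun {base f} {ts} h hs) = fun (H⇒G h) λ i →
    subst (TermOver G) (sym (lookup-strip* ts i)) (strip-termOver H⇒G (hs i))
  strip-termOver H⇒G (fun {sharp f d} h hs)      = var _
  strip-termOver H⇒G (fun {com n} h hs)          = var _

  ♯-defined : ∀ f .(d : Defined ⟪ R ⟫ f) ts → embed {R = R} (fun f ts) ♯ ≡ fun (sharp f d) (embed* ts)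
  ♯-defined f d ts with defined? {R = R} f
  ... | yes _ = refl
  ... | no ¬d = ⊥-elim-irr (¬d d)

  base-defined : ∀ {f} → Defined ⟪ R ⟫ f → Defined ⟪ embeddedRules F R ⟫ (base f)
  base-defined ((fun f ls ⟶ r) , m , refl) = _ , ∈-map⁺ _ m , refl

  -- A type assignment with two sorts.

  data Kind : Set where
    plain tupled : Kind

  -- With every variable `plain`, both sides of an R-rule are `plain` and both sides of a dependency
  -- tuple are `tupled`.
  kinds : TypeAssignment (Ext F R)
  kinds = record
    { Sort = Kind
    ; dom  = λ { (base f) _ → plain ; (sharp f d) _ → plain ; (com n) _ → tupled }
    ; cod  = λ { (base f) → plain ; (sharp f d) → tupled ; (com n) → tupled }
    }

  mutual
    embed-plain : ∀ t → HasType kinds (λ _ → plain) (embed t) plain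
    embed-plain (var x)    = var x
    embed-plain (fun f ts) = fun (embed*-plain ts)

    embed*-plain : ∀ {n} (ts : Vec (Term (sig F)) n) i →
      HasType kinds (λ _ → plain) (lookup (embed* ts) i) plain
    embed*-plain (t ∷ ts) zero    = embed-plain t
    embed*-plain (t ∷ ts) (suc i) = embed*-plain ts i

  sharp-tupled : ∀ s → HasType kinds (λ _ → plain) ⌜ s ⌝ tupled
  sharp-tupled (sharpTerm f d ts) = fun (embed*-plain ts)

-- Derivation heights and runtime complexity of basic terms.

module _ {F : FiniteSignature} (P : DTProblem F) where
  open DTProblem P
  open Simulation P using (Rest; _⇒_; Constructor; com-undefined; arg-dh; app; con)

  rules-typed : ∀ ρ → (𝓓 P ∪ 𝓡 P) ρ → SameType kinds ρ
  rules-typed ρ (inj₁ ρ∈) with ∈-map⁻ _ ρ∈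
  ... | dt s ts , _ , refl = _ , tupled , sharp-tupled s ,
    fun λ i → subst (λ t → HasType kinds _ t tupled) (sym (lookup-map i ⌜_⌝ ts))
      (sharp-tupled (lookup ts i))
  rules-typed ρ (inj₂ ρ∈) with ∈-map⁻ _ ρ∈
  ... | (ℓ ⟶ r) , _ , refl = _ , plain , embed-plain ℓ , embed-plain r

  basic-Cplx≥dh : ∀ t → Basic (𝓓 P ∪ 𝓡 P) t → Cplx P (t ♯) ≥∞ dh t _⇒_
  basic-Cplx≥dh (fun (base f) ts) (basic _ cs) k p with arg-dh (app (con ∘ cs)) p
  ... | refl = inj₁ refl
  basic-Cplx≥dh (fun (sharp f d) ts) (basic _ cs) =
    subst (λ us → Cplx P (fun (sharp f d) us) ≥∞ dh (fun (sharp f d) ts) _⇒_)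
      (map-id ts)
      -- Here the chain tree starts at the given term itself, so `φ` is the identity with inverse
      -- substitution `var`.
      (Simulation.Image.Cplx≥dh P id var (λ f ts → cong (fun (base f)) (sym (map-id ts))) ·-var cs)
  basic-Cplx≥dh (fun (com n) ts) (basic d cs) = ⊥-elim (com-undefined d)

  -- Membership in S is not decided, so D is not split into S and the rest. It is enough that
  -- definedness carries over in one direction and undefinedness likewise.
  union-basic : ∀ {t} → Basic (𝓢 P ∪ Rest) t → Basic (𝓓 P ∪ 𝓡 P) t
  union-basic (basic d cs) = basic (defined d) (termOver-⊆ undefined ∘ cs)
    where
    defined : ∀ {f} → Defined (𝓢 P ∪ Rest) f → Defined (𝓓 P ∪ 𝓡 P) f
    defined (ρ , inj₁ ρ∈S , eq) with ∈-map⁻ _ ρ∈S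
    ... | d , d∈S , refl = _ , inj₁ (∈-map⁺ dtRule (S⊆D d∈S)) , eq
    defined (ρ , inj₂ (inj₁ (ρ∈D , _)) , eq) = ρ , inj₁ ρ∈D , eq
    defined (ρ , inj₂ (inj₂ ρ∈R) , eq)       = ρ , inj₂ ρ∈R , eq

    undefined : ∀ {f} → ¬ Defined (𝓢 P ∪ Rest) f → Constructor f
    undefined ¬d (ρ , inj₁ ρ∈D , eq) =
      -- If `ρ` were in S, it would already contradict `¬d`; this shows that `ρ` lies outside S, and
      -- `¬d` applies again.
      ¬d (ρ , inj₂ (inj₁ (ρ∈D , λ ρ∈S → ¬d (ρ , inj₁ ρ∈S , eq))) , eq)
    undefined ¬d (ρ , inj₂ ρ∈R , eq) = ¬d (ρ , inj₂ (inj₂ ρ∈R) , eq)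

  ircDT≥irc/ : ∀ n → ircDT P n ≥∞ irc/ (𝓢 P) Rest n
  ircDT≥irc/ n _ (inj₁ refl) = inj₁ refl
  ircDT≥irc/ n k (inj₂ ((t , b , t≤n) , p)) = go t (union-basic b) t≤n p
    where
    go : ∀ t → Basic (𝓓 P ∪ 𝓡 P) t → ∣ t ∣ ≤ n → (dh t _⇒_ ≼) k → (ircDT P n ≼) k
    go (fun (base f) ts) (basic _ cs) t≤n p = inj₁ (arg-dh (app (con ∘ cs)) p)
    go (fun (com m) ts)  (basic d cs) t≤n p = ⊥-elim (com-undefined d)
    go (fun (sharp f d) ts) (basic _ cs) t≤n p = inj₂
      ( ( fun f (strip* ts)
        -- `sharp` carries an irrelevant proof of definedness; decidability recovers a usable one.
        , basic (recompute (defined? f) d) (λ i →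
            subst (TermOver _) (sym (lookup-strip* ts i))
              -- Symbols defined by R stay defined after the embedding, so constructors that survive
              -- stripping are constructors of R.
              (strip-termOver (λ c d → c (let ρ , m , eq = base-defined d in ρ , inj₂ m , eq)) (cs i)))
        , ≤-trans (s≤s (strip*-size ts)) t≤n )
      , subst (λ u → (Cplx P u ≼) k) (sym eq)
          (Simulation.Image.Cplx≥dh P (embed ∘ strip) δ
            (λ f ts → cong (fun (base f)) (embed*-strip* ts)) strip-δ cs k p) )
      where
      eq : embed (fun f (strip* ts)) ♯ ≡ fun (sharp f d) (Vec.map (embed ∘ strip) ts)
      eq = trans (♯-defined f d (strip* ts)) (cong (fun (sharp f d)) (embed*-strip* ts))

theorem5p8 : (F : FiniteSignature) (P : DTProblem F) →
    (Σ[ τ ∈ TypeAssignment (Ext F (DTProblem.R P)) ]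
    ((∀ ρ → (𝓓 P ∪ 𝓡 P) ρ → SameType τ ρ)
    × (∀ t → Basic (𝓓 P ∪ 𝓡 P) t → WellTyped τ t →
    Cplx P (t ♯) ≥∞ dh t (Innermost/ (𝓢 P) ((𝓓 P ∖ 𝓢 P) ∪ 𝓡 P)))))
    × (∀ (n : ℕ) → ircDT P n ≥∞ irc/ (𝓢 P) ((𝓓 P ∖ 𝓢 P) ∪ 𝓡 P) n)
theorem5p8 F P = (kinds , rules-typed P , λ t b _ → basic-Cplx≥dh P t b) , ircDT≥irc/ P
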